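{- Elements of $\mathcal{L}_s$ are compared as follows: for all finite $E, F \subseteq \mathcal{X}$, variables $x, y$ and $S, K \in \mathbb{N}$ such that the sublevels involved belong to $\mathcal{L}_s$, (1) $A(E, x, S) \not\leqslant_{\mathcal{L}} B(F, K)$; (2) $B(E, S) \leqslant_{\mathcal{L}} B(F, K) \iff F \subseteq E \land S \leqslant K$; (3) $B(E, S) \leqslant_{\mathcal{L}} A(F, x, K) \iff F \subseteq E \land S \leqslant K + 1$; (4) $A(E, x, S) \leqslant_{\mathcal{L}} A(F, y, K) \iff F \subseteq E \land x = y \land S \leqslant K$.
   Context: $\mathcal{X}$ is a countable set of variables; a valuation is $\sigma\colon\mathcal{X}\to\mathbb{N}$. For finite $E\subseteq\mathcal{X}$, $x\in\mathcal{X}$, $S\in\mathbb{N}$, the sublevels $A(E,x,S)$ and $B(E,S)$ have values $[A(E,x,S)]_\sigma = 0$ if some $y\in E$ has $\sigma(y)=0$, and $\sigma(x)+S$ otherwise; $[B(E,S)]_\sigma=0$ if some $y\in E$ has $\sigma(y)=0$, and $S$ otherwise. $\mathcal{L}_s$ is the set of sublevels $A(E,x,S)$ with $x \in E$ and $B(E,S)$ with $S>0$. For such expressions, $t_1 \leqslant_{\mathcal{L}} t_2$ means $[t_1]_\sigma \le [t_2]_\sigma$ for every valuation $\sigma$. -}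

module Defs where

open import Data.Bool.Base using (if_then_else_)
open import Data.List.Base using (List)
open import Data.List.Membership.Propositional using (_∈_)
open import Data.List.Relation.Unary.Any using (any?)
open import Data.Nat.Base using (ℕ; _+_; _≤_; _>_)
open import Data.Nat.Properties using (_≟_)
open import Function.Bundles using (_↣_)
open import Relation.Nullary.Decidable.Core using (does)

-- Countable in the sense "finite or countably infinite".
Countable : Set → Set
Countable X = X ↣ ℕ

Valuation : Set → Set
Valuation X = X → ℕ

-- A finite subset of X is represented by a list enumerating it; order and
-- repetitions are irrelevant, as only membership and inclusion are used.
FinSubset : Set → Set
FinSubset X = List X

data Sublevel (X : Set) : Set where
  A : (E : FinSubset X) (x : X) (S : ℕ) → Sublevel X
  B : (E : FinSubset X) (S : ℕ) → Sublevel X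

guard : {X : Set} → FinSubset X → Valuation X → ℕ → ℕ
guard E σ n = if does (any? (λ y → σ y ≟ 0) E) then 0 else n

⟦_⟧ : {X : Set} → Sublevel X → Valuation X → ℕ
⟦ A E x S ⟧ σ = guard E σ (σ x + S)
⟦ B E S ⟧ σ = guard E σ S

data 𝓛ₛ {X : Set} : Sublevel X → Set where
  A∈ : ∀ {E x S} → x ∈ E → 𝓛ₛ (A E x S)
  B∈ : ∀ {E S} → S > 0 → 𝓛ₛ (B E S)

infix 4 _≤𝓛_

_≤𝓛_ : {X : Set} → Sublevel X → Sublevel X → Set
_≤𝓛_ {X} t₁ t₂ = (σ : Valuation X) → ⟦ t₁ ⟧ σ ≤ ⟦ t₂ ⟧ σ

{-# OPTIONS --safe #-}
-- Every comparison between guarded expressions is decided by valuations equal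
-- to 1 except at one point: putting 0 at y ∈ F ∖ E kills only the right-hand
-- side, a large value at x separates A from B and A at x from A at y ≢ x, and
-- the constant valuation 1 compares the offsets. Countability provides
-- decidable equality on the variables, which makes these valuations definable.
module Submission where

open import Data.List.Membership.DecPropositional using (_∈?_)
open import Data.List.Membership.Propositional using (_∈_; lose; find)
open import Data.List.Relation.Binary.Subset.Propositional using (_⊆_)
open import Data.List.Relation.Unary.Any using (any?)
open import Data.Nat.Base using (ℕ; suc; _+_; _≤_; _<_; z≤n; s≤s⁻¹)
open import Data.Nat.Properties using (_≟_; ≤-refl; ≤-trans; ≤-reflexive; <⇒≱; n≢0⇒n>0; n>0⇒n≢0; m≤m+n; +-comm; +-monoʳ-≤; +-monoˡ-≤; m+n≡0⇒m≡0; n≤0⇒n≡0)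
open import Data.Product.Base using (_×_; _,_)
open import Function.Base using (_∘_)
open import Function.Bundles using (_⇔_; mk⇔)
open import Relation.Binary.Definitions using (DecidableEquality)
open import Relation.Binary.PropositionalEquality.Core using (_≡_; _≢_; refl; sym; subst; subst₂)
open import Relation.Nullary.Decidable using (yes; no; via-injection; decidable-stable)
open import Relation.Nullary.Negation.Core using (¬_; contradiction)
open import Defs

NonZeroOn : {X : Set} → FinSubset X → Valuation X → Set
NonZeroOn E σ = ∀ {y} → y ∈ E → σ y ≢ 0

module _ {X : Set} where

  guard-≤ : (E : FinSubset X) (σ : Valuation X) (n : ℕ) → guard E σ n ≤ n
  guard-≤ E σ n with any? (λ y → σ y ≟ 0) E
  ... | yes _ = z≤n
  ... | no  _ = ≤-refl

  guard-nonZeroOn : (E : FinSubset X) (σ : Valuation X) (n : ℕ) →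
    NonZeroOn E σ → guard E σ n ≡ n
  guard-nonZeroOn E σ n σ≢0 with any? (λ y → σ y ≟ 0) E
  ... | no  _ = refl
  ... | yes p with (_ , y∈E , σy≡0) ← find p = contradiction σy≡0 (σ≢0 y∈E)

  guard-zero : (E : FinSubset X) (σ : Valuation X) (n : ℕ) {y : X} →
    y ∈ E → σ y ≡ 0 → guard E σ n ≡ 0
  guard-zero E σ n y∈E σy≡0 with any? (λ y → σ y ≟ 0) E
  ... | yes _ = refl
  ... | no ¬p = contradiction (lose y∈E σy≡0) ¬p

  -- A zero on `F` is also a zero on `E`, so both sides vanish together; otherwise the right guard
  -- is open and the left one only lowers `m`. The bound is asked only where `σ` is nonzero on `F`,
  -- so it may exploit that positivity.
  guard-mono : (E F : FinSubset X) (σ : Valuation X) {m n : ℕ} → F ⊆ E →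
    (NonZeroOn F σ → m ≤ n) → guard E σ m ≤ guard F σ n
  guard-mono E F σ {m} F⊆E m≤n with any? (λ y → σ y ≟ 0) F
  ... | no ¬p = ≤-trans (guard-≤ E σ m) (m≤n λ y∈F → ¬p ∘ lose y∈F)
  ... | yes p with (_ , y∈F , σy≡0) ← find p =
    ≤-reflexive (guard-zero E σ m (F⊆E y∈F) σy≡0)

  -- With no zero on `E` the left guard is transparent, while the right guard can only lower `n`.
  guard-≤⇒≤ : (E F : FinSubset X) (σ : Valuation X) {m n : ℕ} → NonZeroOn E σ →
    guard E σ m ≤ guard F σ n → m ≤ n
  guard-≤⇒≤ E F σ {m} {n} σ≢0 le =
    ≤-trans (subst (_≤ _) (guard-nonZeroOn E σ m σ≢0) le) (guard-≤ F σ n)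

  𝟏 : Valuation X
  𝟏 _ = 1

  𝟏-nonZeroOn : {E : FinSubset X} → NonZeroOn E 𝟏
  𝟏-nonZeroOn _ ()

  module _ (_≟ˣ_ : DecidableEquality X) where

    𝟏[_≔_] : X → ℕ → Valuation X
    𝟏[ x ≔ n ] y with y ≟ˣ x
    ... | yes _ = n
    ... | no  _ = 1

    𝟏[≔]-same : (x : X) (n : ℕ) → 𝟏[ x ≔ n ] x ≡ n
    𝟏[≔]-same x n with x ≟ˣ x
    ... | yes _  = refl
    ... | no x≢x = contradiction refl x≢x

    𝟏[≔]-other : {x y : X} (n : ℕ) → y ≢ x → 𝟏[ x ≔ n ] y ≡ 1
    𝟏[≔]-other {x} {y} n y≢x with y ≟ˣ x
    ... | yes y≡x = contradiction y≡x y≢x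
    ... | no  _   = refl

    𝟏[≔suc]-nonZeroOn : {E : FinSubset X} (x : X) (n : ℕ) → NonZeroOn E 𝟏[ x ≔ suc n ]
    𝟏[≔suc]-nonZeroOn x n {y} _ with y ≟ˣ x
    ... | yes _ = λ ()
    ... | no  _ = λ ()

    𝟏[≔0]-nonZeroOn : {E : FinSubset X} {x : X} → ¬ x ∈ E → NonZeroOn E 𝟏[ x ≔ 0 ]
    𝟏[≔0]-nonZeroOn {x = x} x∉E {y} y∈E with y ≟ˣ x
    ... | yes refl = contradiction y∈E x∉E
    ... | no  _    = λ ()

    -- The values `f` and `g` depend on `σ` so that A and B are treated alike. Asking `f σ ≢ 0` only
    -- where `σ` is nonzero on `E` lets `σ x + S` qualify through `x ∈ E`, even for `S` zero.
    guard-≤⇒⊇ : (E F : FinSubset X) (f g : Valuation X → ℕ) →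
      (∀ σ → NonZeroOn E σ → f σ ≢ 0) →
      (∀ σ → guard E σ (f σ) ≤ guard F σ (g σ)) → F ⊆ E
    guard-≤⇒⊇ E F f g f≢0 le {y} y∈F = decidable-stable (_∈?_ _≟ˣ_ y E) λ y∉E →
      let σ   = 𝟏[ y ≔ 0 ]
          σ≢0 = 𝟏[≔0]-nonZeroOn y∉E
      in f≢0 σ σ≢0 (n≤0⇒n≡0
           (subst₂ _≤_ (guard-nonZeroOn E σ (f σ) σ≢0)
             (guard-zero F σ (g σ) y∈F (𝟏[≔]-same y 0)) (le σ)))

    A≰B : (E F : FinSubset X) (x : X) (S K : ℕ) → ¬ (A E x S ≤𝓛 B F K)
    A≰B E F x S K le = <⇒≱ K<σx (≤-trans (m≤m+n (σ x) S) σx+S≤K)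
      where
      -- `suc K` exceeds the bound `K` on the right and, being nonzero, leaves the guard on `E`
      -- open.
      σ = 𝟏[ x ≔ suc K ]
      K<σx : K < σ x
      K<σx = ≤-reflexive (sym (𝟏[≔]-same x (suc K)))
      σx+S≤K : σ x + S ≤ K
      σx+S≤K = guard-≤⇒≤ E F σ (𝟏[≔suc]-nonZeroOn x K) (le σ)

    B≤B⇔ : (E F : FinSubset X) (S K : ℕ) → 0 < S →
      (B E S ≤𝓛 B F K) ⇔ (F ⊆ E × S ≤ K)
    B≤B⇔ E F S K 0<S = mk⇔ to from
      where
      to : B E S ≤𝓛 B F K → F ⊆ E × S ≤ K
      to le = guard-≤⇒⊇ E F (λ _ → S) (λ _ → K) (λ _ _ → n>0⇒n≢0 0<S) le
            , guard-≤⇒≤ E F 𝟏 𝟏-nonZeroOn (le 𝟏)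
      from : F ⊆ E × S ≤ K → B E S ≤𝓛 B F K
      from (F⊆E , S≤K) σ = guard-mono E F σ F⊆E λ _ → S≤K

    B≤A⇔ : (E F : FinSubset X) (x : X) (S K : ℕ) → 0 < S → x ∈ F →
      (B E S ≤𝓛 A F x K) ⇔ (F ⊆ E × S ≤ K + 1)
    B≤A⇔ E F x S K 0<S x∈F = mk⇔ to from
      where
      to : B E S ≤𝓛 A F x K → F ⊆ E × S ≤ K + 1
      to le = guard-≤⇒⊇ E F (λ _ → S) (λ σ → σ x + K) (λ _ _ → n>0⇒n≢0 0<S) le
            -- At `𝟏` the value inside the right guard is `1 + K`.
            , subst (S ≤_) (+-comm 1 K) (guard-≤⇒≤ E F 𝟏 𝟏-nonZeroOn (le 𝟏))
      from : F ⊆ E × S ≤ K + 1 → B E S ≤𝓛 A F x K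
      from (F⊆E , S≤K+1) σ = guard-mono E F σ F⊆E λ σ≢0 →
        -- Since `x ∈ F`, an open guard forces `σ x` to be at least 1: this is the source of the
        -- offset in `K + 1`.
        ≤-trans (subst (S ≤_) (+-comm K 1) S≤K+1) (+-monoˡ-≤ K (n≢0⇒n>0 (σ≢0 x∈F)))

    A≤A⇒≡ : (E F : FinSubset X) (x y : X) (S K : ℕ) → A E x S ≤𝓛 A F y K → x ≡ y
    A≤A⇒≡ E F x y S K le = decidable-stable (x ≟ˣ y) λ x≢y →
      <⇒≱ 1+K<σx (≤-trans (m≤m+n (σ x) S)
        (subst (λ k → σ x + S ≤ k + K) (𝟏[≔]-other (2 + K) (x≢y ∘ sym)) σx+S≤σy+K))
      where
      -- If `x ≢ y` then `σ y` is 1 and the right side is at most `1 + K`; `2 + K` is the least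
      -- value above that.
      σ = 𝟏[ x ≔ 2 + K ]
      1+K<σx : 1 + K < σ x
      1+K<σx = ≤-reflexive (sym (𝟏[≔]-same x (2 + K)))
      σx+S≤σy+K : σ x + S ≤ σ y + K
      σx+S≤σy+K = guard-≤⇒≤ E F σ (𝟏[≔suc]-nonZeroOn x (1 + K)) (le σ)

    A≤A⇔ : (E F : FinSubset X) (x y : X) (S K : ℕ) → x ∈ E →
      (A E x S ≤𝓛 A F y K) ⇔ (F ⊆ E × x ≡ y × S ≤ K)
    A≤A⇔ E F x y S K x∈E = mk⇔ to from
      where
      to : A E x S ≤𝓛 A F y K → F ⊆ E × x ≡ y × S ≤ K
      to le = guard-≤⇒⊇ E F (λ σ → σ x + S) (λ σ → σ y + K)
                (λ σ σ≢0 → σ≢0 x∈E ∘ m+n≡0⇒m≡0 (σ x)) le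
            , A≤A⇒≡ E F x y S K le
            -- At `𝟏` the comparison reads `1 + S ≤ 1 + K`.
            , s≤s⁻¹ (guard-≤⇒≤ E F 𝟏 𝟏-nonZeroOn (le 𝟏))
      from : F ⊆ E × x ≡ y × S ≤ K → A E x S ≤𝓛 A F y K
      from (F⊆E , refl , S≤K) σ = guard-mono E F σ F⊆E λ _ → +-monoʳ-≤ (σ x) S≤K

theorem29 : {X : Set} → Countable X →
    ((E F : FinSubset X) (x : X) (S K : ℕ) → 𝓛ₛ (A E x S) → 𝓛ₛ (B F K) →
    ¬ (A E x S ≤𝓛 B F K))
    × ((E F : FinSubset X) (S K : ℕ) → 𝓛ₛ (B E S) → 𝓛ₛ (B F K) →
    (B E S ≤𝓛 B F K) ⇔ (F ⊆ E × S ≤ K))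
    × ((E F : FinSubset X) (x : X) (S K : ℕ) → 𝓛ₛ (B E S) → 𝓛ₛ (A F x K) →
    (B E S ≤𝓛 A F x K) ⇔ (F ⊆ E × S ≤ K + 1))
    × ((E F : FinSubset X) (x y : X) (S K : ℕ) → 𝓛ₛ (A E x S) → 𝓛ₛ (A F y K) →
    (A E x S ≤𝓛 A F y K) ⇔ (F ⊆ E × x ≡ y × S ≤ K))
theorem29 X↣ℕ =
    (λ E F x S K _ _ → A≰B _≟ˣ_ E F x S K)
  , (λ { E F S K (B∈ 0<S) _ → B≤B⇔ _≟ˣ_ E F S K 0<S })
  , (λ { E F x S K (B∈ 0<S) (A∈ x∈F) → B≤A⇔ _≟ˣ_ E F x S K 0<S x∈F })
  , (λ { E F x y S K (A∈ x∈E) _ → A≤A⇔ _≟ˣ_ E F x y S K x∈E })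
  -- Two variables are equal exactly when their codes in `ℕ` are.
  where _≟ˣ_ = via-injection X↣ℕ _≟_
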